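{- Let $(I,\le_I)$ be a poset and for each $i\in I$ let $(P_i,\le_i)$ be a poset with least element $0_i$. (a) If $\alpha\in[\omega,\omega_1)$ and $I$ and every $P_i$ are $\alpha$-wqo, then the Dress–Schiffels product $\otimes^{DS}_{i\in I}P_i$ is $\alpha$-wqo. (b) If $I$ and every $P_i$ are bqo, then $\otimes^{DS}_{i\in I}P_i$ is bqo. (c) If $I$ and every $P_i$ are $\sigma$-bqo, then $\otimes^{DS}_{i\in I}P_i$ is $\sigma$-bqo.
   Context: $\otimes^{DS}_{i\in I}P_i$ is the set of functions $f$ on $I$ with $f(i)\in P_i$ for all $i$ and finite support $\mathrm{supp}(f)=\{i: f(i)\ne 0_i\}$, ordered by $f\le_{DS}g$ iff $f(i)<_i g(i)$ for every $i$ that is $\le_I$-maximal in $\Delta(f,g)=\{i: f(i)\ne g(i)\}$. A poset is wqo if it has no infinite antichain and no infinite strictly decreasing sequence. A barrier is an infinite set $B\subseteq[\omega]^{<\omega}$ which is an antichain under $\subseteq$ and such that every infinite subset of $\bigcup B$ has an initial segment (set of its $k$ smallest elements, some $k$) in $B$; barriers are well-ordered lexicographically (comparing increasing enumerations) and the type of $B$ is this order type. For nonempty finite $r,s\subseteq\omega$, $r\triangleleft s$ means $\min r<\min s$ and $r\setminus\{\min r\}$ is a proper initial segment of $s$. A map $f:B\to P$ is good if there are $s\triangleleft t$ in $B$ with $f(s)\le_P f(t)$. $P$ is $\alpha$-wqo ($\alpha<\omega_1$) iff every map from a barrier of type $\le\alpha$ into $P$ is good; $P$ is bqo iff it is $\alpha$-wqo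 for all $\alpha<\omega_1$. A poset is $\sigma$-bqo if it is wqo and is a union of countably many subsets each bqo in the induced order. -}

module Defs where

open import Level using (Level) renaming (suc to lsuc; zero to 0ℓ)
open import Data.Nat using (ℕ; suc) renaming (_<_ to _<ℕ_; _≤_ to _≤ℕ_)
open import Data.List using (List; []; _∷_; _++_)
open import Data.List.Membership.Propositional using (_∈_)
open import Data.List.Relation.Unary.Linked using (Linked)
open import Data.List.Relation.Binary.Lex.Strict using (Lex-<)
open import Data.Product using (Σ; ∃; ∃-syntax; _×_; _,_; proj₁)
open import Data.Empty using (⊥)
open import Relation.Nullary using (¬_)
open import Relation.Binary.PropositionalEquality using (_≡_; _≢_)
open import Relation.Binary.Structures using (IsPartialOrder; IsStrictTotalOrder)
open import Induction.WellFounded using (WellFounded)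
open import Function.Definitions using (Injective)

record Poset₀ : Set₁ where
  field
    Carrier : Set
    _≤_     : Carrier → Carrier → Set
    isPO    : IsPartialOrder _≡_ _≤_

record PosetWith0 : Set₁ where
  field
    poset : Poset₀
  open Poset₀ poset public
  field
    0P     : Carrier
    0P-min : ∀ x → 0P ≤ x

record Ordered : Set₁ where
  field
    Carrier : Set
    _≤_     : Carrier → Carrier → Set

Poset⇒Ordered : Poset₀ → Ordered
Poset⇒Ordered P = record { Carrier = Poset₀.Carrier P ; _≤_ = Poset₀._≤_ P }

restrict : (P : Ordered) → (Ordered.Carrier P → Set) → Ordered
restrict P Q = record
  { Carrier = Σ (Ordered.Carrier P) Q
  ; _≤_ = λ x y → Ordered._≤_ P (proj₁ x) (proj₁ y) }

module _ (P : Ordered) where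
  open Ordered P

  _<ₚ_ : Carrier → Carrier → Set
  x <ₚ y = x ≤ y × ¬ (y ≤ x)

  InfiniteAntichain : (ℕ → Carrier) → Set
  InfiniteAntichain x = ∀ m n → m ≢ n → ¬ (x m ≤ x n)

  StrictlyDecreasing : (ℕ → Carrier) → Set
  StrictlyDecreasing x = ∀ n → x (suc n) <ₚ x n

  IsWqo : Set
  IsWqo = ¬ (Σ (ℕ → Carrier) InfiniteAntichain)
        × ¬ (Σ (ℕ → Carrier) StrictlyDecreasing)

-- Finite subsets of ω as strictly increasing lists; barriers

FinSub : Set
FinSub = List ℕ

_⊆ₛ_ : FinSub → FinSub → Set
s ⊆ₛ t = ∀ x → x ∈ s → x ∈ t

InitialSegment : (ℕ → Set) → FinSub → Set
InitialSegment Y s = Linked _<ℕ_ s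
                   × (∀ x → x ∈ s → Y x)
                   × (∀ x y → x ∈ s → Y y → y <ℕ x → y ∈ s)

InfiniteSubsetℕ : (ℕ → Set) → Set
InfiniteSubsetℕ Y = ∀ n → ∃[ m ] (n ≤ℕ m × Y m)

record IsBarrier (B : FinSub → Set) : Set₁ where
  field
    increasing : ∀ s → B s → Linked _<ℕ_ s
    infinite   : ¬ (Σ (List FinSub) λ L → ∀ s → B s → s ∈ L)
    antichain  : ∀ s t → B s → B t → s ⊆ₛ t → s ≡ t
    barrier    : (Y : ℕ → Set)
               → (∀ n → Y n → ∃[ s ] (B s × n ∈ s))
               → InfiniteSubsetℕ Y
               → ∃[ s ] (B s × InitialSegment Y s)

_<lex_ : FinSub → FinSub → Set
_<lex_ = Lex-< _≡_ _<ℕ_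

ProperPrefix : FinSub → FinSub → Set
ProperPrefix r s = ∃[ z ] ∃[ zs ] (r ++ (z ∷ zs) ≡ s)

-- r ◁ s : min r < min s and r ∖ {min r} is a proper initial segment of s
_◁_ : FinSub → FinSub → Set
[] ◁ _ = ⊥
(x ∷ r) ◁ [] = ⊥
(x ∷ r) ◁ (y ∷ s) = x <ℕ y × ProperPrefix r (y ∷ s)

record CountableOrdinal : Set₁ where
  field
    Carrier : Set
    _≺_     : Carrier → Carrier → Set
    isSTO   : IsStrictTotalOrder _≡_ _≺_
    wf      : WellFounded _≺_
    code    : Carrier → ℕ
    code-inj : Injective _≡_ _≡_ code

IsInfiniteOrdinal : CountableOrdinal → Set
IsInfiniteOrdinal α = Σ (ℕ → Carrier) λ e → ∀ m n → m <ℕ n → e m ≺ e n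
  where open CountableOrdinal α

TypeLeq : (B : FinSub → Set) → CountableOrdinal → Set
TypeLeq B α = Σ ((s : FinSub) → B s → Carrier) λ e →
  ∀ s t (bs : B s) (bt : B t) → s <lex t → e s bs ≺ e t bt
  where open CountableOrdinal α

module _ (P : Ordered) where
  open Ordered P

  Good : (B : FinSub → Set) → ((s : FinSub) → B s → Carrier) → Set
  Good B f = ∃[ s ] ∃[ t ] Σ (B s) λ bs → Σ (B t) λ bt →
               (s ◁ t) × (f s bs ≤ f t bt)

  IsαWqo : CountableOrdinal → Set₁
  IsαWqo α = (B : FinSub → Set) → IsBarrier B → TypeLeq B α
           → (f : (s : FinSub) → B s → Carrier) → Good B f

  IsBqo : Set₁
  IsBqo = (α : CountableOrdinal) → IsαWqo α


IsσBqo : Ordered → Set₁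
IsσBqo P = IsWqo P
         × Σ (ℕ → Ordered.Carrier P → Set) λ Q →
             (∀ x → ∃[ n ] Q n x) × (∀ n → IsBqo (restrict P (Q n)))

module DS (I : Poset₀) (P : Poset₀.Carrier I → PosetWith0) where
  open Poset₀ I renaming (Carrier to |I|; _≤_ to _≤I_)
  open PosetWith0

  record Elem : Set where
    field
      fun     : (i : |I|) → Carrier (P i)
      support : List |I|
      finSupp : ∀ i → fun i ≢ 0P (P i) → i ∈ support
  open Elem

  Δ : Elem → Elem → |I| → Set
  Δ f g i = fun f i ≢ fun g i

  MaximalIn : (|I| → Set) → |I| → Set
  MaximalIn D i = D i × (∀ j → D j → i ≤I j → j ≡ i)

  _≤DS_ : Elem → Elem → Set
  f ≤DS g = ∀ i → MaximalIn (Δ f g) i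
          → _≤_ (P i) (fun f i) (fun g i) × fun f i ≢ fun g i

  product : Ordered
  product = record { Carrier = Elem ; _≤_ = _≤DS_ }

{-# OPTIONS --safe #-}
module Submission where

-- Given a bad map F on a barrier, each pair s ◁ t has a maximal i in Δ (F s) (F t) with
-- F s i ≰ F t i, so i lies in the finite support of F s.  By Ramsey's theorem on barriers one may
-- thin out so that i = x s depends on s only, and so that x is either bad, or constant, or
-- strictly ascending along ◁.  The first contradicts the hypothesis on I and the second that on
-- P i.  In the third case every term of x along a chain s₀ ◁ s₁ ◁ ⋯ would lie in the support of
-- F s₀.  Restricting a barrier does not raise its type, whence (a) and (b).  For (c), the wqo part
-- is the case of the barrier of singletons, and the elements whose support and nonzero values
-- lie in the first n pieces form a bqo.

open import Defs
open import Axiom.ExcludedMiddle using (ExcludedMiddle)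
open import Axiom.DoubleNegationElimination using (em⇒dne)
open import Level using (Level; 0ℓ)
open import Data.Nat.Base using (ℕ; zero; suc; _+_; _≤_; _<_; _⊔_; z≤n; s≤s)
import Data.Nat.Properties as ℕ
open import Data.Bool.Base using (Bool; true; false)
open import Data.Empty using (⊥)
open import Data.List.Base using (List; []; _∷_; [_]; _++_; _∷ʳ_; drop; map; length; lookup; upTo)
open import Data.List.Properties using (++-assoc; ++-identityʳ; ++-identityʳ-unique)
open import Data.List.Extrema.Nat using (max; xs≤max)
open import Data.List.Membership.Propositional using (_∈_)
open import Data.List.Membership.Propositional.Properties using (∈-++⁺ˡ; ∈-++⁺ʳ; ∈-map⁺; ∈-upTo⁺)
open import Data.List.Relation.Unary.All as All using (All; []; _∷_)
open import Data.List.Relation.Unary.AllPairs using (AllPairs; []; _∷_)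
open import Data.List.Relation.Unary.Any as Any using (here; there)
open import Data.List.Relation.Unary.Any.Properties using (lookup-index)
open import Data.List.Relation.Unary.Linked using (Linked; [-])
open import Data.List.Relation.Unary.Linked.Properties using (Linked⇒AllPairs)
open import Data.Fin.Base using (toℕ)
open import Data.Fin.Properties using (pigeonhole)
open import Data.Product.Base using (Σ; ∃; ∃₂; ∃-syntax; _×_; _,_; proj₁; proj₂)
open import Data.Sum.Base using (_⊎_; inj₁; inj₂)
open import Function.Base using (_∘_; id)
open import Relation.Binary.Definitions using (tri<; tri≈; tri>)
open import Relation.Binary.Structures using (IsPartialOrder)
open import Relation.Binary.PropositionalEquality
  using (_≡_; _≢_; refl; sym; trans; cong; subst)
open import Relation.Nullary using (¬_; yes; no; contradiction; does)
open import Relation.Unary using (Pred) renaming (_⊆′_ to _⊆_)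

private
  variable
    a ℓ : Level
    C : Set
    X Y Z : Pred ℕ 0ℓ
    k m n : ℕ
    r s t : FinSub

-- Increasing lists and initial segments of sets of natural numbers.

infixl 6 _↾>_
_↾>_ : Pred ℕ 0ℓ → ℕ → Pred ℕ 0ℓ
(Y ↾> n) m = Y m × n < m

↾>-mono : Z ⊆ Y → (Z ↾> n) ⊆ (Y ↾> n)
↾>-mono Z⊆Y m (z , n<m) = Z⊆Y m z , n<m

↾>-infinite : InfiniteSubsetℕ Y → ∀ n → InfiniteSubsetℕ (Y ↾> n)
↾>-infinite inf n k with inf (suc (n + k))
... | m , n+k<m , y = m , ℕ.≤-trans (ℕ.m≤n+m k n) (ℕ.<⇒≤ n+k<m)
                        , y , ℕ.≤-trans (s≤s (ℕ.m≤m+n n k)) n+k<m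

infix 4 _⊒_
-- Finite subsets of `Y` as increasing lists. The tail is taken in the part of `Y` beyond the head,
-- so monotonicity is built in and arguments run by structural induction.
data _⊒_ (Y : Pred ℕ 0ℓ) : FinSub → Set where
  []  : Y ⊒ []
  _∷_ : Y n → Y ↾> n ⊒ s → Y ⊒ n ∷ s

⊒-mono : Z ⊆ Y → Z ⊒ s → Y ⊒ s
⊒-mono Z⊆Y []       = []
⊒-mono Z⊆Y (z ∷ zs) = Z⊆Y _ z ∷ ⊒-mono (↾>-mono Z⊆Y) zs

⊒-∈ : Y ⊒ s → n ∈ s → Y n
⊒-∈ (y ∷ ys) (here refl) = y
⊒-∈ (y ∷ ys) (there n∈s) = proj₁ (⊒-∈ ys n∈s)

⊒-raise : Y ⊒ n ∷ s → m < n → Y ↾> m ⊒ n ∷ s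
⊒-raise (y ∷ ys) m<n = (y , m<n) ∷ ⊒-mono (λ k (y′ , n<k) → (y′ , ℕ.<-trans m<n n<k) , n<k) ys

AllPairs⇒⊒ : AllPairs _<_ s → (∀ n → n ∈ s → Y n) → Y ⊒ s
AllPairs⇒⊒ []         _   = []
AllPairs⇒⊒ (n< ∷ inc) s⊆Y = s⊆Y _ (here refl) ∷
  AllPairs⇒⊒ inc (λ k k∈s → s⊆Y k (there k∈s) , All.lookup n< k∈s)

Linked⇒⊒ : Linked _<_ s → (∀ n → n ∈ s → Y n) → Y ⊒ s
Linked⇒⊒ inc = AllPairs⇒⊒ (Linked⇒AllPairs ℕ.<-trans inc)

-- The inductive counterpart of `InitialSegment`: each entry is the least element of what is left of
-- `Y`, so that segments can be peeled one entry at a time.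
data Init (Y : Pred ℕ 0ℓ) : FinSub → Set where
  []  : Init Y []
  _∷_ : Y n × (∀ {m} → Y m → n ≤ m) → Init (Y ↾> n) s → Init Y (n ∷ s)

Init⇒⊒ : Init Y s → Y ⊒ s
Init⇒⊒ []            = []
Init⇒⊒ ((y , _) ∷ i) = y ∷ Init⇒⊒ i

Init-resp : X ⊆ Y → Y ⊆ X → Init X s → Init Y s
Init-resp X⊆Y Y⊆X []                = []
Init-resp X⊆Y Y⊆X ((x , least) ∷ i) =
  (X⊆Y _ x , least ∘ Y⊆X _) ∷ Init-resp (↾>-mono X⊆Y) (↾>-mono Y⊆X) i

InitialSegment⇒Init : InitialSegment Y s → Init Y s
InitialSegment⇒Init (inc , s⊆Y , down) = go (Linked⇒AllPairs ℕ.<-trans inc) s⊆Y down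
  where
  go : AllPairs _<_ s → (∀ n → n ∈ s → Y n) →
       (∀ n m → n ∈ s → Y m → m < n → m ∈ s) → Init Y s
  go [] _ _ = []
  go {n ∷ s} {Y} (n< ∷ inc) s⊆Y down = (s⊆Y n (here refl) , least) ∷
    go inc (λ k k∈s → s⊆Y k (there k∈s) , All.lookup n< k∈s) down′
    where
    least : Y m → n ≤ m
    least {m} y = ℕ.≮⇒≥ λ m<n → below m<n (down n m (here refl) y m<n)
      where
      below : m < n → ¬ m ∈ n ∷ s
      below m<n (here refl) = ℕ.<-irrefl refl m<n
      below m<n (there m∈s) = ℕ.<-asym m<n (All.lookup n< m∈s)
    down′ : ∀ k m → k ∈ s → (Y ↾> n) m → m < k → m ∈ s
    down′ k m k∈s (y , n<m) m<k with down k m (there k∈s) y m<k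
    ... | here refl = contradiction n<m (ℕ.<-irrefl refl)
    ... | there m∈s = m∈s

-- Both heads are the least element of `Y`, hence equal, and the comparison passes to the tails.
Init-compare : Init Y s → Init Y t → (∃[ q ] s ++ q ≡ t) ⊎ (∃[ q ] t ++ q ≡ s)
Init-compare []      _  = inj₁ (_ , refl)
Init-compare (_ ∷ _) [] = inj₂ (_ , refl)
Init-compare ((x , x≤) ∷ i) ((y , y≤) ∷ j) with ℕ.≤-antisym (x≤ y) (y≤ x)
... | refl with Init-compare i j
...   | inj₁ (q , refl) = inj₁ (q , refl)
...   | inj₂ (q , refl) = inj₂ (q , refl)

-- Unions of a finite set with a set lying beyond it.

infix 4.5 _⊕_
_⊕_ : FinSub → Pred ℕ 0ℓ → Pred ℕ 0ℓ
(s ⊕ X) n = n ∈ s ⊎ X n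

Below : FinSub → Pred ℕ 0ℓ → Set
Below s X = ∀ {n m} → n ∈ s → X m → n < m

⊕-tail-⊆ : (n ∷ s ⊕ X) ↾> n ⊆ (s ⊕ X)
⊕-tail-⊆ m (inj₁ (here refl) , n<n) = contradiction n<n (ℕ.<-irrefl refl)
⊕-tail-⊆ m (inj₁ (there m∈s) , _)   = inj₁ m∈s
⊕-tail-⊆ m (inj₂ x , _)             = inj₂ x

⊕-tail-⊇ : Y ⊒ n ∷ s → Below (n ∷ s) X → (s ⊕ X) ⊆ (n ∷ s ⊕ X) ↾> n
⊕-tail-⊇ (_ ∷ ys) s<X m (inj₁ m∈s) = inj₁ (there m∈s) , proj₂ (⊒-∈ ys m∈s)
⊕-tail-⊇ (_ ∷ ys) s<X m (inj₂ x)   = inj₂ x , s<X (here refl) x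

⊕-head : Y ⊒ n ∷ s → Below (n ∷ s) X → (n ∷ s ⊕ X) m → n ≤ m
⊕-head inc      s<X (inj₁ (here refl)) = ℕ.≤-refl
⊕-head (_ ∷ ys) s<X (inj₁ (there m∈s)) = ℕ.<⇒≤ (proj₂ (⊒-∈ ys m∈s))
⊕-head inc      s<X (inj₂ x)           = ℕ.<⇒≤ (s<X (here refl) x)

Init-⊕ : Y ⊒ s → Below s X → Init (s ⊕ X) s
Init-⊕ []           s<X = []
Init-⊕ (y ∷ ys) s<X = (inj₁ (here refl) , ⊕-head (y ∷ ys) s<X) ∷
  Init-resp (⊕-tail-⊇ (y ∷ ys) s<X) ⊕-tail-⊆ (Init-⊕ ys (s<X ∘ there))

-- Removing the least element `n` from `n ∷ s ⊕ X` leaves `s ⊕ X`, so the entries of `s` can be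
-- cancelled one after another.
Init-⊕-drop : Y ⊒ s → Below s X → Init (s ⊕ X) (s ++ t) → Init X t
Init-⊕-drop []       s<X i = Init-resp (λ { _ (inj₂ x) → x ; _ (inj₁ ()) }) (λ _ → inj₂) i
Init-⊕-drop (y ∷ ys) s<X (_ ∷ i) = Init-⊕-drop ys (s<X ∘ there)
  (Init-resp ⊕-tail-⊆ (⊕-tail-⊇ (y ∷ ys) s<X) i)

⊕-infinite : ∀ s → InfiniteSubsetℕ X → InfiniteSubsetℕ (s ⊕ X)
⊕-infinite s inf n with inf n
... | m , n≤m , x = m , n≤m , inj₂ x

∈⇒≤max : ∀ s → n ∈ s → n ≤ max 0 s
∈⇒≤max s = All.lookup (xs≤max 0 s)

↾>max-Below : ∀ s → Below s (Y ↾> max 0 s)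
↾>max-Below s n∈s (_ , max<m) = ℕ.≤-<-trans (∈⇒≤max s n∈s) max<m

-- Increasing sequences picked from shrinking sets.

module Thinning
  (S : Set₁) (set : S → Pred ℕ 0ℓ) (pick : S → ℕ) (next : S → S)
  (pick∈set : ∀ σ → set σ (pick σ))
  (set-next : ∀ σ → set (next σ) ⊆ set σ ↾> pick σ) where

  iter : ℕ → S → S
  iter zero    σ = σ
  iter (suc k) σ = iter k (next σ)

  -- Each state contributes one number and all later states live beyond it, so the picks increase.
  -- This serves both for diagonal sequences and for chains of failing stems.
  range : S → Pred ℕ 0ℓ
  range σ n = ∃[ k ] pick (iter k σ) ≡ n

  range⊆set : ∀ σ → range σ ⊆ set σ
  range⊆set σ _ (zero  , refl) = pick∈set σ
  range⊆set σ _ (suc k , refl) = proj₁ (set-next σ _ (range⊆set (next σ) _ (k , refl)))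

  range-next-⊆ : ∀ σ → range (next σ) ⊆ range σ ↾> pick σ
  range-next-⊆ σ n (k , eq) = (suc k , eq) , proj₂ (set-next σ n (range⊆set (next σ) n (k , eq)))

  range-next-⊇ : ∀ σ → range σ ↾> pick σ ⊆ range (next σ)
  range-next-⊇ σ n ((zero  , refl) , p<p) = contradiction p<p (ℕ.<-irrefl refl)
  range-next-⊇ σ n ((suc k , eq)   , _)   = k , eq

  pick-least : ∀ σ → range σ n → pick σ ≤ n
  pick-least σ (zero  , refl) = ℕ.≤-refl
  pick-least σ (suc k , eq)   = ℕ.<⇒≤ (proj₂ (range-next-⊆ σ _ (k , eq)))

  -- Whatever is picked beyond the `k`-th pick is picked by a later state, hence lies in the set
  -- prepared for that pick.
  range-tail : ∀ k σ → range σ ↾> pick (iter k σ) ⊆ range (next (iter k σ))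
  range-tail zero    σ = range-next-⊇ σ
  range-tail (suc k) σ n (r , p<n) = range-tail k (next σ) n
    (range-next-⊇ σ n (r , ℕ.<-trans (proj₂ (range-next-⊆ σ _ (k , refl))) p<n) , p<n)

  pick-iter-≥ : ∀ k σ → k ≤ pick (iter k σ)
  pick-iter-≥ k σ = ℕ.≤-trans (ℕ.m≤m+n k _) (go k σ)
    where
    go : ∀ k σ → k + pick σ ≤ pick (iter k σ)
    go zero    σ = ℕ.≤-refl
    go (suc k) σ = begin
      suc k + pick σ      ≡⟨ ℕ.+-suc k (pick σ) ⟨
      k + suc (pick σ)    ≤⟨ ℕ.+-monoʳ-≤ k (proj₂ (set-next σ _ (pick∈set (next σ)))) ⟩
      k + pick (next σ)   ≤⟨ go k (next σ) ⟩
      pick (iter (suc k) σ) ∎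
      where open ℕ.≤-Reasoning

  range-infinite : ∀ σ → InfiniteSubsetℕ (range σ)
  range-infinite σ n = pick (iter n σ) , pick-iter-≥ n σ , n , refl

Refinement : Pred ℕ 0ℓ → (Pred ℕ 0ℓ → Set ℓ) → Set _
Refinement Y Q = Σ (Pred ℕ 0ℓ) λ Z → Z ⊆ Y × InfiniteSubsetℕ Z × Q Z

-- The shift relation and barriers.

◁⇒tail : s ◁ t → ∃[ q ] drop 1 s ++ q ≡ t
◁⇒tail {s = _ ∷ _} {t = _ ∷ _} (_ , z , zs , eq) = z ∷ zs , eq

-- The union of `s` and `t`, listed increasingly, is `s ++ q`, since `t` is the tail of `s`
-- continued by `q`.
◁⇒⊒ : Y ⊒ s → Y ⊒ t → s ◁ t → ∀ {q} → drop 1 s ++ q ≡ t → Y ⊒ s ++ q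
◁⇒⊒ {t = _ ∷ _} (y ∷ _) t∈Y (x<y , _) eq =
  y ∷ subst (_ ⊒_) (sym eq) (⊒-raise t∈Y x<y)

⋃ : (FinSub → Set) → Pred ℕ 0ℓ
⋃ B n = ∃[ s ] (B s × n ∈ s)

infixl 6 _↾_
_↾_ : (FinSub → Set) → Pred ℕ 0ℓ → FinSub → Set
(B ↾ Z) s = B s × Z ⊒ s

module Barrier {B : FinSub → Set} (isBarrier : IsBarrier B) where
  open IsBarrier isBarrier

  initial : X ⊆ ⋃ B → InfiniteSubsetℕ X → ∃[ s ] (B s × Init X s)
  initial {X} X⊆B inf with barrier X X⊆B inf
  ... | s , b , i = s , b , InitialSegment⇒Init i

  ⊒-member : B s → ⋃ B ⊒ s
  ⊒-member {s} b = Linked⇒⊒ (increasing _ b) λ n n∈s → s , b , n∈s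

  prefix-≡ : ∀ s {q} → B s → B (s ++ q) → q ≡ []
  prefix-≡ s bs bsq =
    ++-identityʳ-unique s (antichain _ _ bs bsq λ _ → ∈-++⁺ˡ)

  -- The empty set lies in every member, so an antichain containing it has no other member, and `B`
  -- would be finite.
  nonempty : ¬ B []
  nonempty b = infinite ([ [] ] , λ s bs → here (prefix-≡ [] b bs))

  ⊈-tail : B (n ∷ s) → B (m ∷ t) → n < m → ¬ (m ∷ t) ⊆ₛ s
  ⊈-tail bs bt n<m t⊆s with antichain _ _ bt bs (λ k → there ∘ t⊆s k)
  ... | refl = ℕ.<-irrefl refl n<m

  -- Both `s` and `t` begin `X` without `n`, so one extends the other. By the antichain property `t`
  -- is not contained in `s`, hence `s` is a proper initial segment of `t`.
  shift : B (n ∷ s) → Init X (n ∷ s) → B t → Init (X ↾> n) t → (n ∷ s) ◁ t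
  shift {t = []} _ _ bt _ = contradiction bt nonempty
  shift {s = s} {t = _ ∷ _} bs (_ ∷ i) bt j@(((_ , n<m) , _) ∷ _) with Init-compare i j
  ... | inj₁ (z ∷ zs , eq) = n<m , z , zs , eq
  ... | inj₁ ([] , eq)     = contradiction
        (λ k → subst (k ∈_) (trans (sym eq) (++-identityʳ s))) (⊈-tail bs bt n<m)
  ... | inj₂ (q , refl)    = contradiction (λ _ → ∈-++⁺ˡ) (⊈-tail bs bt n<m)

  ◁-initial : X ⊆ ⋃ B → InfiniteSubsetℕ X → B (n ∷ s) → Init X (n ∷ s) →
              ∃[ t ] (B t × Init (X ↾> n) t × (n ∷ s) ◁ t)
  ◁-initial {n = n} X⊆B inf bs i
    with initial (λ m → X⊆B m ∘ proj₁) (↾>-infinite inf n)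
  ... | t , bt , j = t , bt , j , shift bs i bt j

  Init-unique : B s → B t → Init X s → Init X t → s ≡ t
  Init-unique {s = s} {t = t} bs bt i j with Init-compare i j
  ... | inj₁ (q , refl) = trans (sym (++-identityʳ s)) (cong (s ++_) (sym (prefix-≡ s bs bt)))
  ... | inj₂ (q , refl) = trans (cong (t ++_) (prefix-≡ t bt bs)) (++-identityʳ t)

  -- Let `X` be `s` together with the elements of `Y` beyond it. Then `s` begins `X`, and the member
  -- that begins `X` without its least element is the required `t`.
  successor : Y ⊆ ⋃ B → InfiniteSubsetℕ Y → (B ↾ Y) s → ∃[ t ] ((B ↾ Y) t × s ◁ t)
  successor {s = []} _ _ (bs , _) = contradiction bs nonempty
  successor {Y} {s = s@(_ ∷ _)} Y⊆B inf (bs , s∈Y) =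
    let t , bt , i , s◁t = ◁-initial (λ n → Y⊆B n ∘ X⊆Y n)
                             (⊕-infinite s (↾>-infinite inf (max 0 s))) bs
                             (Init-⊕ s∈Y (↾>max-Below {Y = Y} s))
    in t , (bt , ⊒-mono (λ n → X⊆Y n ∘ proj₁) (Init⇒⊒ i)) , s◁t
    where
    X⊆Y : (s ⊕ Y ↾> max 0 s) ⊆ Y
    X⊆Y n (inj₁ n∈s)     = ⊒-∈ s∈Y n∈s
    X⊆Y n (inj₂ (y , _)) = y

  restriction : Z ⊆ ⋃ B → InfiniteSubsetℕ Z → IsBarrier (B ↾ Z)
  restriction {Z} Z⊆B Z-inf = record
    { increasing = λ s (bs , _) → increasing s bs
    ; infinite   = λ (L , cover) → not-finite L cover
    ; antichain  = λ s t (bs , _) (bt , _) → antichain s t bs bt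
    ; barrier    = λ Y Y⊆ Y-inf → let s , bs , i = barrier Y (λ n y → ⊆⋃ (Y⊆ n y)) Y-inf in
        s , (bs , Linked⇒⊒ (proj₁ i) λ n n∈s → ⊆Z (Y⊆ n (proj₁ (proj₂ i) n n∈s))) , i
    }
    where
    ⊆⋃ : ⋃ (B ↾ Z) n → ⋃ B n
    ⊆⋃ (s , (bs , _) , n∈s) = s , bs , n∈s

    ⊆Z : ⋃ (B ↾ Z) n → Z n
    ⊆Z (s , (_ , s∈Z) , n∈s) = ⊒-∈ s∈Z n∈s

    not-finite : ∀ L → ¬ (∀ s → (B ↾ Z) s → s ∈ L)
    -- A member inside `Z` whose least element exceeds every number occurring in `L` cannot belong
    -- to `L`.
    not-finite L cover with initial {X = Z ↾> max 0 (map (max 0) L)}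
                              (λ n → Z⊆B n ∘ proj₁) (↾>-infinite Z-inf _)
    ... | [] , bs , _ = nonempty bs
    ... | n ∷ s , bs , i@(((_ , bound<n) , _) ∷ _) = ℕ.<⇒≱ bound<n (ℕ.≤-trans
      (∈⇒≤max (n ∷ s) (here refl))
      (∈⇒≤max (map (max 0) L) (∈-map⁺ (max 0) (cover _ (bs , ⊒-mono (λ _ → proj₁) (Init⇒⊒ i))))))

-- The subsets of the interval from `m` to `m + k`, right end excluded. They show that a bounded
-- `⋃ B` would leave only finitely many members.
sublists : ℕ → ℕ → List FinSub
sublists m zero    = [ [] ]
sublists m (suc k) = sublists (suc m) k ++ map (m ∷_) (sublists (suc m) k)

∈-sublists : ∀ k → (λ n → m ≤ n × n < k + m) ⊒ s → s ∈ sublists m k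
∈-sublists zero    []                = here refl
∈-sublists zero    ((m≤n , n<m) ∷ _) = contradiction n<m (ℕ.≤⇒≯ m≤n)
∈-sublists (suc k) []                = ∈-++⁺ˡ (∈-sublists k [])
∈-sublists {m} (suc k) (_∷_ {n} (m≤n , n<k) ns) with m ℕ.≟ n
... | yes refl = ∈-++⁺ʳ (sublists (suc m) k) (∈-map⁺ (m ∷_) (∈-sublists k
        (⊒-mono (λ l ((_ , l<) , m<l) → m<l , subst (l <_) (sym (ℕ.+-suc k m)) l<) ns)))
... | no m≢n = ∈-++⁺ˡ (∈-sublists k (⊒-mono
        (λ l ((_ , l<) , m<l) → m<l , subst (l <_) (sym (ℕ.+-suc k m)) l<)
        (⊒-raise {Y = λ l → m ≤ l × l < suc k + m} ((m≤n , n<k) ∷ ns) (ℕ.≤∧≢⇒< m≤n m≢n))))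

-- Classical choice, the pigeonhole principle and bar induction.

module Classical (em : ∀ {ℓ} → ExcludedMiddle ℓ) where

  dne : ∀ {A : Set ℓ} → ¬ ¬ A → A
  dne = em⇒dne em

  -- The witnesses supplied by `f` may vary with the proof of `P a`. Deciding `P a` fixes one proof,
  -- which makes the witness a function of `a` alone, with `default` outside `P`.
  choose : ∀ {A : Set a} {P : A → Set} {Q : A → C → Set} → C →
           (∀ a → P a → ∃ (Q a)) → Σ (A → C) λ g → ∀ a → P a → Q a (g a)
  choose {C = C} {A = A} {P} {Q} default f = g , g-spec
    where
    g : A → C
    g a with em {P = P a}
    ... | yes p = proj₁ (f a p)
    ... | no  _ = default
    g-spec : ∀ a → P a → Q a (g a)
    g-spec a p with em {P = P a}
    ... | yes p′ = proj₂ (f a p′)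
    ... | no ¬p  = contradiction p ¬p

  -- If every colour class were bounded, the maximum of the finitely many bounds would bound `Y`.
  infinite-pigeonhole : InfiniteSubsetℕ Y → (c : ∀ n → Y n → C) (L : List C) →
    (∀ n y → c n y ∈ L) →
    ∃[ d ] (d ∈ L × InfiniteSubsetℕ λ n → Σ (Y n) λ y → c n y ≡ d)
  infinite-pigeonhole {Y} {C} inf c L c∈L = dne λ none →
    let N , bound = finite L λ d d∈L infd → none (d , d∈L , infd)
        m , N≤m , y = inf N
    in bound m N≤m y (c∈L m y)
    where
    finite : ∀ L → (∀ d → d ∈ L → ¬ InfiniteSubsetℕ λ n → Σ (Y n) λ y → c n y ≡ d) →
             ∃[ N ] (∀ n → N ≤ n → ∀ y → ¬ c n y ∈ L)
    finite [] _ = 0 , λ _ _ _ ()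
    finite (d ∷ L) fin with finite L (λ e → fin e ∘ there)
    ... | N , bound = N ⊔ M , λ where
          n N≤n y (here eq) → M-bound n (ℕ.≤-trans (ℕ.m≤n⊔m N M) N≤n) (y , eq)
          n N≤n y (there c∈) → bound n (ℕ.≤-trans (ℕ.m≤m⊔n N M) N≤n) y c∈
      where
      bounded : ∃[ M ] (∀ n → M ≤ n → ¬ Σ (Y n) λ y → c n y ≡ d)
      bounded = dne λ unbounded → fin d (here refl) λ M → dne λ none →
        unbounded (M , λ n M≤n p → none (n , M≤n , p))
      M = proj₁ bounded
      M-bound = proj₂ bounded

  -- The setting is a property `Φ s Y` of stems `s`, hereditary in `Y`. By `bar` every infinite set
  -- has an initial segment at which `Φ` can be achieved inside any infinite set; by `step` it
  -- passes from the one-point extensions of a stem to the stem.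
  module _ (Φ : FinSub → Pred ℕ 0ℓ → Set)
           (Φ-mono : ∀ s {Y Z} → Z ⊆ Y → Φ s Y → Φ s Z)
           (Y₀ : Pred ℕ 0ℓ)
           (step : ∀ s Y → Y ⊆ Y₀ → InfiniteSubsetℕ Y →
                   (∀ n → Y n → Φ (s ∷ʳ n) (Y ↾> n)) → Refinement Y (Φ s))
           (bar : ∀ X → X ⊆ Y₀ → InfiniteSubsetℕ X → ∃[ r ] (Init X r ×
                  (∀ Y → Y ⊆ Y₀ → InfiniteSubsetℕ Y → Refinement Y (Φ r)))) where

    private
      Bad : FinSub → Pred ℕ 0ℓ → Set₁
      Bad s Y = Y ⊆ Y₀ × InfiniteSubsetℕ Y × ¬ Refinement Y (Φ s)

      Extension : FinSub → Pred ℕ 0ℓ → Set₁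
      Extension s Y = ∃[ n ] Σ (Pred ℕ 0ℓ) λ Y′ → Y n × Y′ ⊆ Y ↾> n × Bad (s ∷ʳ n) Y′

      extend : ∀ s Y → Bad s Y → Extension s Y
      extend s Y (Y⊆Y₀ , Y-inf , bad) = dne λ none →
        let refine : ∀ n → Y n → ∀ Y′ → Y′ ⊆ Y ↾> n → InfiniteSubsetℕ Y′ →
                     Refinement Y′ (Φ (s ∷ʳ n))
            refine n y Y′ sub inf = dne λ bad′ →
              none (n , Y′ , y , sub , (λ m → Y⊆Y₀ m ∘ proj₁ ∘ sub m) , inf , bad′)
            open Diagonal refine
            Z , Z⊆D , Z-inf , φ = step s (range start)
              (λ m → Y⊆Y₀ m ∘ range⊆set start m) (range-infinite start)
              -- The diagonal set beyond its `k`-th pick lies in the set refined for that pick, so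
              -- `Φ` descends to it.
              λ { n (k , refl) → Φ-mono _ (λ m → range⊆set _ m ∘ range-tail k start m)
                                          (homogeneous (iter k start)) }
        in bad (Z , (λ m → range⊆set start m ∘ Z⊆D m) , Z-inf , φ)
        where
        module Diagonal (refine : ∀ n → Y n → ∀ Y′ → Y′ ⊆ Y ↾> n → InfiniteSubsetℕ Y′ →
                                  Refinement Y′ (Φ (s ∷ʳ n))) where
          S : Set₁
          S = Σ (Pred ℕ 0ℓ) λ Z → Z ⊆ Y × InfiniteSubsetℕ Z

          pick : S → ℕ
          pick (_ , _ , inf) = proj₁ (inf 0)

          pick∈ : ∀ σ → proj₁ σ (pick σ)
          pick∈ (_ , _ , inf) = proj₂ (proj₂ (inf 0))

          refinement : ∀ σ → Refinement (proj₁ σ ↾> pick σ) (Φ (s ∷ʳ pick σ))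
          refinement σ@(Z , Z⊆Y , inf) =
            refine (pick σ) (Z⊆Y _ (pick∈ σ)) (Z ↾> pick σ) (↾>-mono Z⊆Y) (↾>-infinite inf _)

          next : S → S
          next σ@(Z , Z⊆Y , inf) with refinement σ
          ... | W , W⊆Z , W-inf , _ = W , (λ m → Z⊆Y m ∘ proj₁ ∘ W⊆Z m) , W-inf

          homogeneous : ∀ σ → Φ (s ∷ʳ pick σ) (proj₁ (next σ))
          homogeneous σ with refinement σ
          ... | _ , _ , _ , φ = φ

          next-⊆ : ∀ σ → proj₁ (next σ) ⊆ proj₁ σ ↾> pick σ
          next-⊆ σ with refinement σ
          ... | _ , W⊆Z , _ , _ = W⊆Z

          open Thinning S proj₁ pick next pick∈ next-⊆ public

          start : S
          start = Y , (λ _ → id) , Y-inf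

      S : Set₁
      S = ∃[ s ] Σ (Pred ℕ 0ℓ) (Bad s)

      set : S → Pred ℕ 0ℓ
      set (_ , Y , _) = Y

      pick : S → ℕ
      pick (s , Y , bad) = proj₁ (extend s Y bad)

      next : S → S
      next (s , Y , bad) with extend s Y bad
      ... | n , Y′ , _ , _ , bad′ = s ∷ʳ n , Y′ , bad′

      pick∈ : ∀ σ → set σ (pick σ)
      pick∈ (s , Y , bad) with extend s Y bad
      ... | _ , _ , y , _ = y

      next-⊆ : ∀ σ → set (next σ) ⊆ set σ ↾> pick σ
      next-⊆ (s , Y , bad) with extend s Y bad
      ... | _ , _ , _ , sub , _ = sub

      next-stem : ∀ σ → proj₁ (next σ) ≡ proj₁ σ ∷ʳ pick σ
      next-stem (s , Y , bad) with extend s Y bad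
      ... | _ = refl

      open Thinning S set pick next pick∈ next-⊆

      -- The picks, in order, are exactly the numbers appended to the stem, so an initial segment of
      -- the range extends the stem to another failing stem.
      Init-bad : ∀ σ → Init (range σ) r → Σ (Pred ℕ 0ℓ) (Bad (proj₁ σ ++ r))
      Init-bad (s , Y , bad) [] =
        subst (λ s → Σ (Pred ℕ 0ℓ) (Bad s)) (sym (++-identityʳ s)) (Y , bad)
      Init-bad {n ∷ r} σ ((n∈ , least) ∷ i) = subst (λ s → Σ (Pred ℕ 0ℓ) (Bad s)) stem≡
        (Init-bad (next σ) (Init-resp (range-next-⊇ σ) (range-next-⊆ σ)
          (subst (λ n → Init (range σ ↾> n) r) n≡pick i)))
        where
        n≡pick : n ≡ pick σ
        n≡pick = ℕ.≤-antisym (least (0 , refl)) (pick-least σ n∈)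
        stem≡ : proj₁ (next σ) ++ r ≡ proj₁ σ ++ n ∷ r
        stem≡ = trans (cong (_++ r) (next-stem σ))
          (trans (++-assoc (proj₁ σ) [ pick σ ] r) (cong (λ n → proj₁ σ ++ n ∷ r) (sym n≡pick)))

    -- If Φ failed densely at [], some one-point extension would again fail (otherwise step
    -- applies to a diagonal sequence), and the chain of failing stems would avoid the bar.
    abstract
      bar-induction : InfiniteSubsetℕ Y₀ → Refinement Y₀ (Φ [])
      bar-induction inf = dne λ bad →
        let σ = [] , Y₀ , (λ _ → id) , inf , bad
            r , i , dense = bar (range σ) (range⊆set σ) (range-infinite σ)
            Y , Y⊆Y₀ , Y-inf , bad′ = Init-bad σ i
        in bad′ (dense Y Y⊆Y₀ Y-inf)

  -- T is a front of coloured finite sets.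
  ramsey : (T : FinSub → C → Set) (L : List C) (Y : Pred ℕ 0ℓ) → InfiniteSubsetℕ Y →
           (∀ {r c} → T r c → c ∈ L) →
           (∀ {r q c d} → T r c → T (r ++ q) d → c ≡ d) →
           (∀ X → X ⊆ Y → InfiniteSubsetℕ X → ∃₂ λ r c → Init X r × T r c) →
           Refinement Y λ Z → ∃[ c ] (c ∈ L × (∀ r d → Z ⊒ r → T r d → d ≡ c))
  ramsey {C} T L Y Y-inf T⇒L coherent bar = bar-induction Φ mono Y step bar′ Y-inf
    where
    Φ : FinSub → Pred ℕ 0ℓ → Set
    Φ s Z = ∃[ c ] (c ∈ L × (∀ q d → Z ⊒ q → T (s ++ q) d → d ≡ c))

    mono : ∀ s {Y Z} → Z ⊆ Y → Φ s Y → Φ s Z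
    mono s Z⊆Y (c , c∈L , φ) = c , c∈L , λ q d → φ q d ∘ ⊒-mono Z⊆Y

    leaf : ∀ {s c} → T s c → ∀ Y → InfiniteSubsetℕ Y → Refinement Y (Φ s)
    leaf {c = c} p Y inf =
      Y , (λ _ → id) , inf , c , T⇒L p , λ q d _ p′ → sym (coherent p p′)

    bar′ : ∀ X → X ⊆ Y → InfiniteSubsetℕ X → ∃[ r ] (Init X r ×
           (∀ Z → Z ⊆ Y → InfiniteSubsetℕ Z → Refinement Z (Φ r)))
    bar′ X X⊆Y inf with bar X X⊆Y inf
    ... | r , c , i , p = r , i , λ Z _ → leaf p Z

    step : ∀ s Z → Z ⊆ Y → InfiniteSubsetℕ Z →
           (∀ n → Z n → Φ (s ∷ʳ n) (Z ↾> n)) → Refinement Z (Φ s)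
    step s Z _ inf φ with em {P = ∃ (T s)}
    ... | yes (_ , p) = leaf p Z inf
    -- Every `n` in `Z` has its own colour for the extensions of `s ∷ʳ n`; the points sharing one
    -- colour are kept.
    ... | no ¬leaf
      with infinite-pigeonhole inf (λ n z → proj₁ (φ n z)) L (λ n z → proj₁ (proj₂ (φ n z)))
    ...   | c , c∈L , W-inf = W , (λ _ → proj₁) , W-inf , c , c∈L , constant
      where
      W : Pred ℕ 0ℓ
      W n = Σ (Z n) λ z → proj₁ (φ n z) ≡ c
      constant : ∀ q d → W ⊒ q → T (s ++ q) d → d ≡ c
      constant [] d _ p = contradiction (d , subst (λ s → T s d) (++-identityʳ s) p) ¬leaf
      constant (n ∷ q) d ((z , eq) ∷ w) p = trans
        (proj₂ (proj₂ (φ n z)) q d (⊒-mono (↾>-mono λ _ → proj₁) w)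
          (subst (λ s → T s d) (sym (++-assoc s [ n ] q)) p)) eq

  -- Ramsey theory for pairs `s ◁ t` in a barrier.

  module Ramsey {B : FinSub → Set} (isBarrier : IsBarrier B) where
    open Barrier isBarrier

    private
      -- Here `q` is the part of `s` not yet absorbed in the stem and `p` the part of `t` beyond
      -- `s`, so `q ++ p` is what `Z` contributes to the union of `s` and `t`.
      Stable : (FinSub → FinSub → C) → (FinSub → List C) → Pred ℕ 0ℓ → FinSub → FinSub → Set
      Stable K L Z s q = ∃[ c ] (c ∈ L s ×
        (∀ p t → Z ⊒ q ++ p → drop 1 s ++ p ≡ t → B t → s ◁ t → K s t ≡ c))

    -- For fixed `s`, the sets `q` that complete the tail of `s` to a member `t` with `s ◁ t` form a
    -- front beyond `s`; `ramsey` is applied to their colouring by `K s`.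
    stable-leaf : (K : FinSub → FinSub → C) (L : FinSub → List C) →
      (∀ {s t} → B s → B t → s ◁ t → K s t ∈ L s) → B s →
      Y ⊆ ⋃ B → InfiniteSubsetℕ Y → Refinement Y λ Z → Stable K L Z s []
    stable-leaf {s = []} K L K∈L bs Y⊆B Y-inf = contradiction bs nonempty
    stable-leaf {C} {s = s@(x ∷ r)} {Y} K L K∈L bs Y⊆B Y-inf = refine
      (ramsey T (L s) (Y ↾> max 0 s) (↾>-infinite Y-inf _) T⇒L coherent bar)
      where
      T : FinSub → C → Set
      T q c = B (r ++ q) × s ◁ (r ++ q) × K s (r ++ q) ≡ c

      T⇒L : ∀ {q c} → T q c → c ∈ L s
      T⇒L (bt , s◁t , refl) = K∈L bs bt s◁t

      coherent : ∀ {q p c d} → T q c → T (q ++ p) d → c ≡ d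
      coherent {q} {p} (bt , _ , refl) (bt′ , _ , refl) = cong (K s ∘ (r ++_))
        (trans (sym (++-identityʳ q))
          (cong (q ++_) (sym (prefix-≡ (r ++ q) bt (subst B (sym (++-assoc r q p)) bt′)))))

      module _ (X : Pred ℕ 0ℓ) (X⊆Y : X ⊆ Y ↾> max 0 s) (X-inf : InfiniteSubsetℕ X) where
        s<X : Below s X
        s<X n∈s = ↾>max-Below {Y = Y} s n∈s ∘ X⊆Y _

        s⊕X⊆B : (s ⊕ X) ⊆ ⋃ B
        s⊕X⊆B n (inj₁ n∈s) = s , bs , n∈s
        s⊕X⊆B n (inj₂ x)   = Y⊆B n (proj₁ (X⊆Y n x))

        leaf : ∀ {t} → B t → Init ((s ⊕ X) ↾> x) t → s ◁ t → ∃[ q ] r ++ q ≡ t →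
               ∃₂ λ q c → Init X q × T q c
        leaf bt i s◁t (q , refl) =
          q , K s (r ++ q) , Init-⊕-drop (⊒-member bs) s<X
            ((inj₁ (here refl) , ⊕-head (⊒-member bs) s<X) ∷ i) , bt , s◁t , refl

        bar : ∃₂ λ q c → Init X q × T q c
        bar = let t , bt , i , s◁t = ◁-initial s⊕X⊆B (⊕-infinite s X-inf) bs
                                       (Init-⊕ (⊒-member bs) s<X)
              in leaf bt i s◁t (◁⇒tail s◁t)

      refine : Refinement (Y ↾> max 0 s) (λ Z → ∃[ c ] (c ∈ L s × (∀ q d → Z ⊒ q → T q d → d ≡ c))) →
               Refinement Y λ Z → Stable K L Z s []
      refine (Z , Z⊆Y , Z-inf , c , c∈L , φ) =
        Z , (λ n → proj₁ ∘ Z⊆Y n) , Z-inf , c , c∈L ,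
        λ { p t z refl bt s◁t → φ p _ z (bt , s◁t , refl) }

    -- The finite palette `L s` may change with `s`, so no single colour can be expected. Bar
    -- induction carries out `stable-leaf` for all members at once, leaving a colour that depends on
    -- `s` only.
    stabilise : C → (K : FinSub → FinSub → C) (L : FinSub → List C) →
      (∀ {s t} → B s → B t → s ◁ t → K s t ∈ L s) →
      Y ⊆ ⋃ B → InfiniteSubsetℕ Y →
      Refinement Y λ Z → Σ (FinSub → C) λ k → ∀ s → (B ↾ Z) s → k s ∈ L s ×
        (∀ t → (B ↾ Z) t → s ◁ t → K s t ≡ k s)
    stabilise {Y = Y} default K L K∈L Y⊆B Y-inf =
      select (bar-induction Φ mono Y step bar Y-inf)
      where
      Φ : FinSub → Pred ℕ 0ℓ → Set
      Φ s Z = ∀ q w → s ++ q ≡ w → B w → Z ⊒ q → Stable K L Z w q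

      mono : ∀ s {Y Z} → Z ⊆ Y → Φ s Y → Φ s Z
      mono s Z⊆Y φ q w eq bw zs with φ q w eq bw (⊒-mono Z⊆Y zs)
      ... | c , c∈L , stable = c , c∈L , λ p t → stable p t ∘ ⊒-mono Z⊆Y

      leaf : ∀ s → B s → ∀ Z → Z ⊆ Y → InfiniteSubsetℕ Z → Refinement Z (Φ s)
      leaf s bs Z Z⊆Y inf with stable-leaf K L K∈L bs (λ n → Y⊆B n ∘ Z⊆Y n) inf
      ... | W , W⊆Z , W-inf , stable = W , W⊆Z , W-inf , φ
        where
        φ : Φ s W
        φ q w refl bw ws with prefix-≡ s bs bw
        ... | refl = subst (λ s → Stable K L W s []) (sym (++-identityʳ s)) stable

      step : ∀ s Z → Z ⊆ Y → InfiniteSubsetℕ Z →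
             (∀ n → Z n → Φ (s ∷ʳ n) (Z ↾> n)) → Refinement Z (Φ s)
      step s Z Z⊆Y inf φ with em {P = B s}
      ... | yes bs = leaf s bs Z Z⊆Y inf
      ... | no ¬bs = Z , (λ _ → id) , inf , φ′
        where
        φ′ : Φ s Z
        φ′ [] w refl bw _ = contradiction (subst B (++-identityʳ s) bw) ¬bs
        φ′ (n ∷ q) w eq bw (z ∷ zs) with φ n z q w (trans (++-assoc s [ n ] q) eq) bw zs
        ... | c , c∈L , stable = c , c∈L , λ { p t (_ ∷ zs) → stable p t zs }

      bar : ∀ X → X ⊆ Y → InfiniteSubsetℕ X → ∃[ r ] (Init X r ×
            (∀ Z → Z ⊆ Y → InfiniteSubsetℕ Z → Refinement Z (Φ r)))
      bar X X⊆Y inf with initial (λ n → Y⊆B n ∘ X⊆Y n) inf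
      ... | s , bs , i = s , i , leaf s bs

      select : Refinement Y (Φ []) → Refinement Y λ Z → Σ (FinSub → _) λ k →
        ∀ s → (B ↾ Z) s → k s ∈ L s × (∀ t → (B ↾ Z) t → s ◁ t → K s t ≡ k s)
      select (Z , Z⊆Y , Z-inf , φ) =
        let k , k-spec = choose default λ s ((bs , s∈Z) : (B ↾ Z) s) → φ s s refl bs s∈Z
        in Z , Z⊆Y , Z-inf , k , λ s s∈ → proj₁ (k-spec s s∈) , λ t (bt , t∈Z) s◁t →
          let q , eq = ◁⇒tail s◁t
          in proj₂ (k-spec s s∈) q t (◁⇒⊒ (proj₂ s∈) t∈Z s◁t eq) eq bt s◁t

    homogeneous : (k : FinSub → C) (L : List C) → (∀ {s} → B s → Y ⊒ s → k s ∈ L) →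
      Y ⊆ ⋃ B → InfiniteSubsetℕ Y →
      Refinement Y λ Z → ∃[ c ] (c ∈ L × (∀ s → (B ↾ Z) s → k s ≡ c))
    homogeneous {Y = Y} k L k∈L Y⊆B Y-inf =
      let Z , Z⊆Y , Z-inf , c , c∈L , φ = ramsey T L Y Y-inf T⇒L coherent bar
      in Z , Z⊆Y , Z-inf , c , c∈L , λ s (bs , s∈Z) → φ s _ s∈Z ((bs , ⊒-mono Z⊆Y s∈Z) , refl)
      where
      T : FinSub → _ → Set
      T s c = (B ↾ Y) s × k s ≡ c

      T⇒L : ∀ {s c} → T s c → c ∈ L
      T⇒L ((bs , s∈Y) , refl) = k∈L bs s∈Y

      coherent : ∀ {r q c d} → T r c → T (r ++ q) d → c ≡ d
      coherent {r} ((bs , _) , refl) ((bt , _) , refl) =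
        cong k (trans (sym (++-identityʳ r)) (cong (r ++_) (sym (prefix-≡ r bs bt))))

      bar : ∀ X → X ⊆ Y → InfiniteSubsetℕ X → ∃₂ λ r c → Init X r × T r c
      bar X X⊆Y inf = let s , bs , i = initial (λ n → Y⊆B n ∘ X⊆Y n) inf
                      in s , k s , i , (bs , ⊒-mono X⊆Y (Init⇒⊒ i)) , refl

    Pairs : Pred ℕ 0ℓ → (FinSub → FinSub → Set) → Set
    Pairs Z R = ∀ s t → (B ↾ Z) s → (B ↾ Z) t → s ◁ t → R s t

    -- First the truth value of `R s t` is made to depend on `s` alone, then `homogeneous` makes it
    -- constant.
    dichotomy : (R : FinSub → FinSub → Set) → Y ⊆ ⋃ B → InfiniteSubsetℕ Y →
      Refinement Y λ Z → Pairs Z R ⊎ Pairs Z λ s t → ¬ R s t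
    dichotomy {Y = Y} R Y⊆B Y-inf =
      let Z , Z⊆Y , Z-inf , k , k-spec = stabilise true colour (λ _ → bools)
                                           (λ _ _ _ → ∈-bools _) Y⊆B Y-inf
          W , W⊆Z , W-inf , c , c∈ , k≡c = homogeneous k bools
            (λ bs s∈Z → proj₁ (k-spec _ (bs , s∈Z))) (λ n → Y⊆B n ∘ Z⊆Y n) Z-inf
      in W , (λ n → Z⊆Y n ∘ W⊆Z n) , W-inf , decide c λ s t s∈@(bs , s∈W) (bt , t∈W) s◁t → trans
        (proj₂ (k-spec s (bs , ⊒-mono W⊆Z s∈W)) t (bt , ⊒-mono W⊆Z t∈W) s◁t) (k≡c s s∈)
      where
      bools : List Bool
      bools = true ∷ false ∷ []

      ∈-bools : ∀ b → b ∈ bools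
      ∈-bools true  = here refl
      ∈-bools false = there (here refl)

      colour : FinSub → FinSub → Bool
      colour s t = does (em {P = R s t})

      decide : ∀ c → Pairs Z (λ s t → colour s t ≡ c) → Pairs Z R ⊎ Pairs Z λ s t → ¬ R s t
      decide true eq = inj₁ λ s t s∈ t∈ s◁t → does-true (eq s t s∈ t∈ s◁t)
        where
        does-true : ∀ {s t} → colour s t ≡ true → R s t
        does-true {s} {t} eq with em {P = R s t}
        ... | yes r = r
      decide false eq = inj₂ λ s t s∈ t∈ s◁t → does-false (eq s t s∈ t∈ s◁t)
        where
        does-false : ∀ {s t} → colour s t ≡ false → ¬ R s t
        does-false {s} {t} eq with em {P = R s t}
        ... | no ¬r = ¬r

    ⋃-infinite : InfiniteSubsetℕ (⋃ B)
    ⋃-infinite n = dne λ none → infinite (sublists 0 n , λ s bs → ∈-sublists n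
      (⊒-mono (λ m m∈B → z≤n , subst (m <_) (sym (ℕ.+-identityʳ n))
                (ℕ.≰⇒> λ n≤m → none (m , n≤m , m∈B))) (⊒-member bs)))
      where open IsBarrier isBarrier using (infinite)

    -- Both `s` and `t` are joined by chains along `◁` to the member `u` that begins the part of `Y`
    -- beyond them.
    all-equal : (x : FinSub → C) → Y ⊆ ⋃ B → InfiniteSubsetℕ Y → Pairs Y (λ s t → x s ≡ x t) →
                ∀ {s t} → (B ↾ Y) s → (B ↾ Y) t → x s ≡ x t
    all-equal {Y = Y} x Y⊆B Y-inf step {s} {t} s∈ t∈ =
      let u , bu , i = initial (λ n → Y⊆B n ∘ proj₁) (↾>-infinite Y-inf (max 0 s ⊔ max 0 t))
      in trans (link s∈ (ℕ.m≤m⊔n _ _) bu i) (sym (link t∈ (ℕ.m≤n⊔m (max 0 s) _) bu i))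
      where
      -- The list `r` holds what remains of the original finite set: each shift drops its least
      -- element, until the member reached begins `X` itself.
      connect : ∀ X → X ⊆ Y → InfiniteSubsetℕ X → ∀ r → Below r X → Y ⊒ r →
                ∀ {s t} → B s → Init (r ⊕ X) s → B t → Init X t → x s ≡ x t
      connect X X⊆Y inf [] r<X _ bs i bt j = cong x
        (Init-unique bs bt (Init-resp (λ { _ (inj₁ ()) ; _ (inj₂ x) → x }) (λ _ → inj₂) i) j)
      connect X X⊆Y inf (n ∷ r) r<X (y ∷ ys) {[]} bs i bt j = contradiction bs nonempty
      connect X X⊆Y inf (n ∷ r) r<X (y ∷ ys) {m ∷ s} bs i@((m∈ , m≤) ∷ _) bt j
        with ℕ.≤-antisym (m≤ (inj₁ (here refl))) (⊕-head (y ∷ ys) r<X m∈)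
      ... | refl =
        let X⊕⊆Y = λ k → λ { (inj₁ k∈r) → ⊒-∈ (y ∷ ys) k∈r ; (inj₂ x) → X⊆Y k x }
            u , bu , i′ , s◁u = ◁-initial (λ k → Y⊆B k ∘ X⊕⊆Y k) (⊕-infinite (n ∷ r) inf) bs i
        in trans (step _ u (bs , ⊒-mono X⊕⊆Y (Init⇒⊒ i))
                           (bu , ⊒-mono (λ k → X⊕⊆Y k ∘ proj₁) (Init⇒⊒ i′)) s◁u)
                 (connect X X⊆Y inf r (r<X ∘ there) (⊒-mono (λ _ → proj₁) ys) bu
                   (Init-resp ⊕-tail-⊆ (⊕-tail-⊇ (y ∷ ys) r<X) i′) bt j)

      link : ∀ {s u N} → (B ↾ Y) s → max 0 s ≤ N → B u → Init (Y ↾> N) u → x s ≡ x u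
      link {s} {N = N} (bs , s∈Y) max≤N bu i =
        connect (Y ↾> N) (λ _ → proj₁) (↾>-infinite Y-inf N) s s<X s∈Y bs (Init-⊕ s∈Y s<X) bu i
        where
        s<X : Below s (Y ↾> N)
        s<X n∈s (_ , N<m) = ℕ.≤-<-trans (ℕ.≤-trans (∈⇒≤max s n∈s) max≤N) N<m

  GoodPair : (FinSub → Set) → (FinSub → FinSub → Set) → Set
  GoodPair B R = ∃₂ λ s t → B s × B t × s ◁ t × R s t

  module _ (I : Poset₀) where
    open Poset₀ I renaming (Carrier to |I|; _≤_ to _≤I_)
    open IsPartialOrder isPO using () renaming (refl to ≤I-refl; trans to ≤I-trans; antisym to ≤I-antisym)

    -- A strictly ascending sequence never repeats, whereas one inside `L` would repeat among its
    -- first `suc (length L)` terms.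
    ascending-escapes : (L : List |I|) (x : ℕ → |I|) →
      (∀ k → x k ≤I x (suc k) × x k ≢ x (suc k)) → ¬ (∀ k → x k ∈ L)
    ascending-escapes L x asc x∈L =
      let i , j , i<j , eq = pigeonhole (ℕ.n<1+n (length L)) (λ i → Any.index (x∈L (toℕ i)))
          xi≡xj = trans (lookup-index (x∈L (toℕ i)))
                    (trans (cong (lookup L) eq) (sym (lookup-index (x∈L (toℕ j)))))
          o , i+o≡j = ℕ.m≤n⇒∃[o]m+o≡n i<j
      in proj₂ (asc (toℕ i)) (≤I-antisym (proj₁ (asc (toℕ i)))
           (subst (x (suc (toℕ i)) ≤I_) (trans (cong x i+o≡j) (sym xi≡xj)) (mono (suc (toℕ i)) o)))
      where
      mono : ∀ i d → x i ≤I x (i + d)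
      mono i zero    = subst (λ j → x i ≤I x j) (sym (ℕ.+-identityʳ i)) ≤I-refl
      mono i (suc d) = subst (λ j → x i ≤I x j) (sym (ℕ.+-suc i d))
                         (≤I-trans (mono i d) (proj₁ (asc (i + d))))

  -- Bad maps into the Dress-Schiffels product, and transitivity of its order.

  module Product (I : Poset₀) (P : Poset₀.Carrier I → PosetWith0) where
    open Poset₀ I renaming (Carrier to |I|; _≤_ to _≤I_)
    open PosetWith0 using (0P; 0P-min)
    open DS I P
    open Elem

    infix 4 _⊢_≼_
    _⊢_≼_ : ∀ i → PosetWith0.Carrier (P i) → PosetWith0.Carrier (P i) → Set
    i ⊢ p ≼ q = PosetWith0._≤_ (P i) p q

    NonZero : Elem → |I| → Set
    NonZero f i = fun f i ≢ 0P (P i)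

    -- On `Δ f g` the values already differ, so strictness can fail only through the failure of the
    -- weak inequality.
    obstruction : ∀ {f g} → ¬ f ≤DS g →
                  ∃[ i ] (MaximalIn (Δ f g) i × ¬ i ⊢ fun f i ≼ fun g i)
    obstruction f≰g = dne λ none → f≰g λ i max →
      dne (λ ≰ → none (i , max , λ le → ≰ (le , proj₁ max)))

    ≰⇒NonZero : ∀ {i x y} → ¬ i ⊢ x ≼ y → x ≢ 0P (P i)
    ≰⇒NonZero {i} x≰y refl = x≰y (0P-min (P i) _)

    -- The hypotheses concern only restrictions of `B`, indices in the supports and nonzero values.
    -- In this form one argument covers α-wqo factors, wqo factors, and σ-bqo factors cut down to
    -- finitely many pieces.
    good : {B : FinSub → Set} → IsBarrier B → (F : FinSub → Elem) →
      (∀ Z → Z ⊆ ⋃ B → InfiniteSubsetℕ Z → (x : FinSub → |I|) →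
        (∀ s → (B ↾ Z) s → NonZero (F s) (x s)) →
        GoodPair (B ↾ Z) λ s t → x s ≤I x t) →
      (∀ Z → Z ⊆ ⋃ B → InfiniteSubsetℕ Z → ∀ i →
        (∀ s → (B ↾ Z) s → NonZero (F s) i) →
        GoodPair (B ↾ Z) λ s t → i ⊢ fun (F s) i ≼ fun (F t) i) →
      GoodPair B λ s t → F s ≤DS F t
    good {B} isBarrier F I-good P-good = dne λ bad →
      let obstr : ∀ ((s , t) : FinSub × FinSub) → B s × B t × s ◁ t → ∃ (Obstr s t)
          obstr (s , t) (bs , bt , s◁t) = obstruction {F s} {F t} λ le → bad (s , t , bs , bt , s◁t , le)
          -- The obstruction at one fixed pair supplies the default index that `choose` requires.
          s₀ , bs₀ , _ = initial (λ _ → id) ⋃-infinite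
          t₀ , (bt₀ , _) , s₀◁t₀ = successor (λ _ → id) ⋃-infinite (bs₀ , ⊒-member bs₀)
          κ , κ-obstr = choose (proj₁ (obstr (s₀ , t₀) (bs₀ , bt₀ , s₀◁t₀))) obstr
          -- The obstructing index lies in the support of `F s`, a finite palette that depends on
          -- `s` alone.
          Z , Z⊆B , Z-inf , x , x-spec = stabilise (κ (s₀ , t₀)) (λ s t → κ (s , t)) (support ∘ F)
            (λ {s} {t} bs bt s◁t → finSupp (F s) _ (≰⇒NonZero (proj₂ (κ-obstr (s , t) (bs , bt , s◁t)))))
            (λ _ → id) ⋃-infinite
          x-obstr : Pairs Z λ s t → Obstr s t (x s)
          x-obstr s t s∈ t∈ s◁t = subst (Obstr s t) (proj₂ (x-spec s s∈) t t∈ s◁t)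
            (κ-obstr (s , t) (proj₁ s∈ , proj₁ t∈ , s◁t))
      in refute Z Z⊆B Z-inf x x-obstr
      where
      open Barrier isBarrier
      open Ramsey isBarrier

      Obstr : FinSub → FinSub → |I| → Set
      Obstr s t i = MaximalIn (Δ (F s) (F t)) i × ¬ i ⊢ fun (F s) i ≼ fun (F t) i

      Pairs-mono : ∀ {R : FinSub → FinSub → Set} {W Z} → W ⊆ Z → Pairs Z R → Pairs W R
      Pairs-mono W⊆Z all s t (bs , ss) (bt , ts) = all s t (bs , ⊒-mono W⊆Z ss) (bt , ⊒-mono W⊆Z ts)

      module _ (Z : Pred ℕ 0ℓ) (Z⊆B : Z ⊆ ⋃ B) (Z-inf : InfiniteSubsetℕ Z)
               (x : FinSub → |I|) (x-obstr : Pairs Z λ s t → Obstr s t (x s)) where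

        nonzero : ∀ s → (B ↾ Z) s → NonZero (F s) (x s)
        nonzero s s∈ = let t , t∈ , s◁t = successor Z⊆B Z-inf s∈
                       in ≰⇒NonZero (proj₂ (x-obstr s t s∈ t∈ s◁t))

        -- Above x s the functions F s and F t agree, so along a chain s₀ ◁ s₁ ◁ ⋯ with x
        -- increasing every x sₙ lies in the finite support of F s₀.
        not-ascending : Pairs Z (λ s t → x s ≤I x t) → Pairs Z (λ s t → x s ≢ x t) → ⊥
        not-ascending le ne = ascending-escapes I (support (F (σ 0))) (x ∘ σ)
          (λ k → le _ _ (σ∈ k) (σ∈ (suc k)) (σ◁ k) , ne _ _ (σ∈ k) (σ∈ (suc k)) (σ◁ k))
          λ k → finSupp (F (σ 0)) _ (subst (NonZero (F (σ 0)) ∘ x ∘ σ) (ℕ.+-identityʳ k) (in-support k 0))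
          where
          chain : ℕ → ∃ (B ↾ Z)
          chain zero    = let s , bs , i = initial Z⊆B Z-inf in s , bs , Init⇒⊒ i
          chain (suc k) = let t , t∈ , _ = successor Z⊆B Z-inf (proj₂ (chain k)) in t , t∈
          σ : ℕ → FinSub
          σ k = proj₁ (chain k)
          σ∈ : ∀ k → (B ↾ Z) (σ k)
          σ∈ k = proj₂ (chain k)
          σ◁ : ∀ k → σ k ◁ σ (suc k)
          σ◁ k = proj₂ (proj₂ (successor Z⊆B Z-inf (proj₂ (chain k))))
          mono : ∀ d j → x (σ j) ≤I x (σ (d + j))
          mono zero    j = IsPartialOrder.refl isPO
          mono (suc d) j = IsPartialOrder.trans isPO (mono d j)
            (le _ _ (σ∈ (d + j)) (σ∈ (suc d + j)) (σ◁ (d + j)))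
          in-support : ∀ d j → NonZero (F (σ j)) (x (σ (d + j)))
          in-support zero    j = nonzero (σ j) (σ∈ j)
          in-support (suc d) j Fj≡0 =
            let i = x (σ (suc d + j))
                (_ , maximal) , _ = x-obstr _ _ (σ∈ j) (σ∈ (suc j)) (σ◁ j)
                -- If the functions differed at `i`, which is above `x (σ j)`, maximality would give
                -- `i ≡ x (σ j)`. Then `x (σ (suc j))` would be below `x (σ j)`, against strict
                -- ascent.
                agree : fun (F (σ j)) i ≡ fun (F (σ (suc j))) i
                agree = dne λ differ → ne _ _ (σ∈ j) (σ∈ (suc j)) (σ◁ j)
                  (IsPartialOrder.antisym isPO (le _ _ (σ∈ j) (σ∈ (suc j)) (σ◁ j))
                    (subst (x (σ (suc j)) ≤I_) (maximal i differ (mono (suc d) j))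
                       (subst (λ k → x (σ (suc j)) ≤I x (σ k)) (ℕ.+-suc d j) (mono d (suc j)))))
            in subst (NonZero (F (σ (suc j))) ∘ x ∘ σ) (ℕ.+-suc d j) (in-support d (suc j))
                 (trans (sym agree) Fj≡0)

        -- Equality along `◁` is equality on the whole restriction, so all obstructions sit in a
        -- single factor, where `P-good` applies.
        not-constant : Pairs Z (λ s t → x s ≡ x t) → ⊥
        not-constant eq =
          let s₀ , bs₀ , i = initial Z⊆B Z-inf
              same : ∀ s → (B ↾ Z) s → x s ≡ x s₀
              same s s∈ = all-equal x Z⊆B Z-inf eq s∈ (bs₀ , Init⇒⊒ i)
              s , t , s∈ , t∈ , s◁t , le = P-good Z Z⊆B Z-inf (x s₀)
                λ s s∈ → subst (NonZero (F s)) (same s s∈) (nonzero s s∈)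
          in proj₂ (subst (Obstr s t) (same s s∈) (x-obstr s t s∈ t∈ s◁t)) le

      -- The dichotomy is used twice: for the order between `x s` and `x t`, then, on the ascending
      -- side, for their equality.
      refute : ∀ Z → Z ⊆ ⋃ B → InfiniteSubsetℕ Z → (x : FinSub → |I|) →
               Pairs Z (λ s t → Obstr s t (x s)) → ⊥
      refute Z Z⊆B Z-inf x obstr = compare (dichotomy (λ s t → x s ≤I x t) Z⊆B Z-inf)
        where
        Dichotomy : (FinSub → FinSub → Set) → Pred ℕ 0ℓ → Set
        Dichotomy R W = Pairs W R ⊎ Pairs W λ s t → ¬ R s t

        equate : ∀ {W} → W ⊆ Z → Pairs W (λ s t → x s ≤I x t) →
                 Refinement W (Dichotomy λ s t → x s ≡ x t) → ⊥
        equate W⊆Z le (V , V⊆W , V-inf , inj₁ eq) =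
          let V⊆Z = λ n → W⊆Z n ∘ V⊆W n
          in not-constant V (λ n → Z⊆B n ∘ V⊆Z n) V-inf x (Pairs-mono V⊆Z obstr) eq
        equate W⊆Z le (V , V⊆W , V-inf , inj₂ ne) =
          let V⊆Z = λ n → W⊆Z n ∘ V⊆W n
          in not-ascending V (λ n → Z⊆B n ∘ V⊆Z n) V-inf x (Pairs-mono V⊆Z obstr) (Pairs-mono V⊆W le) ne

        compare : Refinement Z (Dichotomy λ s t → x s ≤I x t) → ⊥
        compare (W , W⊆Z , W-inf , inj₁ le) =
          equate W⊆Z le (dichotomy (λ s t → x s ≡ x t) (λ n → Z⊆B n ∘ W⊆Z n) W-inf)
        compare (W , W⊆Z , W-inf , inj₂ none) =
          let W⊆B = λ n → Z⊆B n ∘ W⊆Z n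
              s , t , s∈ , t∈ , s◁t , le = I-good W W⊆B W-inf x
                (nonzero W W⊆B W-inf x (Pairs-mono W⊆Z obstr))
          in none s t s∈ t∈ s◁t le

    -- If no maximal element lay above `i`, one could climb strictly inside `D` forever, yet `D` is
    -- contained in a finite list.
    below-maximal : (D : |I| → Set) (L : List |I|) → (∀ {i} → D i → i ∈ L) →
                    ∀ {i} → D i → ∃[ m ] (MaximalIn D m × i ≤I m)
    below-maximal D L D⊆L {i} i∈D = dne λ none →
      let climb : (σ : ∃[ j ] (D j × i ≤I j)) → Σ (∃[ k ] (D k × i ≤I k)) λ τ →
                  proj₁ σ ≤I proj₁ τ × proj₁ σ ≢ proj₁ τ
          climb (j , j∈D , i≤j) = dne λ stuck → none (j , (j∈D , λ k k∈D j≤k → dne λ k≢j →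
            stuck ((k , k∈D , ≤I-trans i≤j j≤k) , j≤k , k≢j ∘ sym)) , i≤j)
          chain = λ k → iterate (proj₁ ∘ climb) (i , i∈D , ≤I-refl) k
      in ascending-escapes I L (proj₁ ∘ chain) (λ k → proj₂ (climb (chain k)))
           (λ k → D⊆L (proj₁ (proj₂ (chain k))))
      where
      open IsPartialOrder isPO using () renaming (refl to ≤I-refl; trans to ≤I-trans)
      iterate : ∀ {A : Set} → (A → A) → A → ℕ → A
      iterate f x zero    = x
      iterate f x (suc k) = f (iterate f x k)

    -- Above `i` take `m` maximal in the union of `Δ f g` and `Δ g h`. There `f` is below `g`, `g`
    -- is below `h`, and one of the two inequalities is strict; so `m` lies in `Δ f h` and equals
    -- `i` by maximality.
    ≤DS-trans : ∀ f g h → f ≤DS g → g ≤DS h → f ≤DS h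
    ≤DS-trans f g h f≤g g≤h i (fi≢hi , maximal) =
      let m , (m∈D , m-max) , i≤m = below-maximal D (support f ++ support g ++ support h) D⊆ i∈D
          open IsPartialOrder (PosetWith0.isPO (P m)) renaming (trans to ≼-trans; antisym to ≼-antisym)
          fm≼gm = at-maximal f g f≤g m λ j → m-max j ∘ inj₁
          gm≼hm = at-maximal g h g≤h m λ j → m-max j ∘ inj₂
          fm≢hm : fun f m ≢ fun h m
          fm≢hm eq =
            let gm≡fm = ≼-antisym (subst (m ⊢ fun g m ≼_) (sym eq) gm≼hm) fm≼gm
            in case⊎ (λ f≢g → f≢g (sym gm≡fm)) (λ g≢h → g≢h (trans gm≡fm eq)) m∈D
          m≡i = maximal m fm≢hm i≤m
      in subst (λ i → i ⊢ fun f i ≼ fun h i × fun f i ≢ fun h i) m≡i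
           (≼-trans fm≼gm gm≼hm , fm≢hm)
      where
      case⊎ : ∀ {A B : Set} → ¬ A → ¬ B → ¬ (A ⊎ B)
      case⊎ ¬a ¬b (inj₁ a) = ¬a a
      case⊎ ¬a ¬b (inj₂ b) = ¬b b

      D : |I| → Set
      D j = Δ f g j ⊎ Δ g h j

      i∈D : D i
      i∈D = dne λ i∉D → fi≢hi (trans (dne (i∉D ∘ inj₁)) (dne (i∉D ∘ inj₂)))

      Δ⊆ : ∀ u v {j} → Δ u v j → j ∈ support u ⊎ j ∈ support v
      Δ⊆ u v {j} differ = dne λ j∉ → differ (trans
        (dne λ uj≢0 → j∉ (inj₁ (finSupp u j uj≢0)))
        (sym (dne λ vj≢0 → j∉ (inj₂ (finSupp v j vj≢0)))))

      D⊆ : ∀ {j} → D j → j ∈ support f ++ support g ++ support h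
      D⊆ (inj₁ d) with Δ⊆ f g d
      ... | inj₁ j∈f = ∈-++⁺ˡ j∈f
      ... | inj₂ j∈g = ∈-++⁺ʳ (support f) (∈-++⁺ˡ j∈g)
      D⊆ (inj₂ d) with Δ⊆ g h d
      ... | inj₁ j∈g = ∈-++⁺ʳ (support f) (∈-++⁺ˡ j∈g)
      ... | inj₂ j∈h = ∈-++⁺ʳ (support f) (∈-++⁺ʳ (support g) j∈h)

      at-maximal : ∀ u v → u ≤DS v → ∀ m → (∀ j → Δ u v j → m ≤I j → j ≡ m) →
                   m ⊢ fun u m ≼ fun v m
      at-maximal u v u≤v m max with em {P = Δ u v m}
      ... | yes differ = proj₁ (u≤v m (differ , max))
      ... | no ¬differ = IsPartialOrder.reflexive (PosetWith0.isPO (P m)) (dne ¬differ)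

  -- The value `f s bs` may depend on the proof `bs`. One value is fixed for each member, and a good
  -- pair for these values is a good pair for `f`.
  Good-total : (P : Ordered) {B : FinSub → Set} → IsBarrier B →
    (f : (s : FinSub) → B s → Ordered.Carrier P) →
    ((F : FinSub → Ordered.Carrier P) → GoodPair B λ s t → Ordered._≤_ P (F s) (F t)) →
    Good P B f
  Good-total P {B} isBarrier f good =
    let open Barrier isBarrier
        open Ramsey isBarrier
        s₀ , bs₀ , _ = initial (λ _ → id) ⋃-infinite
        F , F≡f = choose {P = B} {Q = λ s p → ∃[ bs ] f s bs ≡ p} (f s₀ bs₀)
                    λ s bs → f s bs , bs , refl
        s , t , bs , bt , s◁t , Fs≤Ft = good F
        bs′ , eqs = F≡f s bs
        bt′ , eqt = F≡f t bt
    in s , t , bs′ , bt′ , s◁t ,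
       subst (λ p → Ordered._≤_ P p (f t bt′)) (sym eqs)
         (subst (Ordered._≤_ P (F s)) (sym eqt) Fs≤Ft)

  -- Passage of the hypotheses to restricted barriers.

  TypeLeq-↾ : ∀ {B Z} α → TypeLeq B α → TypeLeq (B ↾ Z) α
  TypeLeq-↾ α (e , e-mono) =
    (λ s (bs , _) → e s bs) , λ s t (bs , _) (bt , _) → e-mono s t bs bt

  αWqo-↾ : (P : Ordered) (α : CountableOrdinal) → IsαWqo P α →
    ∀ {B} → IsBarrier B → TypeLeq B α → ∀ Z → Z ⊆ ⋃ B → InfiniteSubsetℕ Z →
    (x : FinSub → Ordered.Carrier P) → GoodPair (B ↾ Z) λ s t → Ordered._≤_ P (x s) (x t)
  αWqo-↾ P α wqo {B} isBarrier type≤ Z Z⊆B Z-inf x =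
    let s , t , s∈ , t∈ , s◁t , le = wqo (B ↾ Z) (Barrier.restriction isBarrier Z⊆B Z-inf)
                                       (TypeLeq-↾ {B} α type≤) (λ s _ → x s)
    in s , t , s∈ , t∈ , s◁t , le

  -- Members are coloured by the index of a piece containing their value. With finitely many
  -- colours, some restriction sends everything into one bqo piece.
  bqo-union-↾ : (P : Ordered) (Q : ℕ → Ordered.Carrier P → Set) → (∀ n → IsBqo (restrict P (Q n))) →
    (α : CountableOrdinal) → ∀ {B} → IsBarrier B → TypeLeq B α → ∀ N Z → Z ⊆ ⋃ B → InfiniteSubsetℕ Z →
    (x : FinSub → Ordered.Carrier P) → (∀ s → (B ↾ Z) s → ∃[ k ] (k ≤ N × Q k (x s))) →
    GoodPair (B ↾ Z) λ s t → Ordered._≤_ P (x s) (x t)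
  bqo-union-↾ P Q bqo α {B} isBarrier type≤ N Z Z⊆B Z-inf x x∈Q =
    let open Ramsey isBarrier
        k , k-spec = choose 0 x∈Q
        W , W⊆Z , W-inf , c , _ , k≡c = homogeneous k (upTo (suc N))
          (λ bs s∈Z → ∈-upTo⁺ (s≤s (proj₁ (k-spec _ (bs , s∈Z))))) Z⊆B Z-inf
        widen : (B ↾ W) ⊆ (B ↾ Z)
        widen = λ s (bs , s∈W) → bs , ⊒-mono W⊆Z s∈W
        s , t , s∈ , t∈ , s◁t , le = bqo c α (B ↾ W)
          (Barrier.restriction isBarrier (λ n → Z⊆B n ∘ W⊆Z n) W-inf) (TypeLeq-↾ {B} α type≤)
          λ s s∈ → x s , subst (λ k → Q k (x s)) (k≡c s s∈) (proj₂ (k-spec s (widen s s∈)))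
    in s , t , widen s s∈ , widen t t∈ , s◁t , le

  -- Wqo posets and the barrier of singletons.

  Singleton : FinSub → Set
  Singleton s = ∃[ n ] s ≡ [ n ]

  least : InfiniteSubsetℕ Y → ∃[ n ] (Y n × (∀ m → Y m → n ≤ m))
  least {Y} inf = let n , _ , y = inf 0 in go n n ℕ.≤-refl y
    where
    go : ∀ k n → n ≤ k → Y n → ∃[ n ] (Y n × (∀ m → Y m → n ≤ m))
    go k n n≤k y with em {P = ∃[ m ] (Y m × m < n)}
    ... | no none = n , y , λ m y′ → ℕ.≮⇒≥ λ m<n → none (m , y′ , m<n)
    go zero    n n≤0 y | yes (m , y′ , m<n) = contradiction (ℕ.<-≤-trans m<n n≤0) λ ()
    go (suc k) n n≤k y | yes (m , y′ , m<n) = go k m (ℕ.≤-pred (ℕ.<-≤-trans m<n n≤k)) y′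

  -- On singletons `◁` is the order of ω, so maps from this barrier are ordinary sequences.
  singletons : IsBarrier Singleton
  singletons = record
    { increasing = λ { _ (n , refl) → [-] }
    ; infinite   = λ (L , cover) → ℕ.1+n≰n (ℕ.≤-trans (∈⇒≤max [ _ ] (here refl))
        (∈⇒≤max (map (max 0) L) (∈-map⁺ (max 0) (cover _ (_ , refl)))))
    ; antichain  = λ { _ _ (m , refl) (n , refl) m⊆n → cong [_] (∈-[] (m⊆n m (here refl))) }
    ; barrier    = λ Y _ inf → let n , y , n≤ = least inf in [ n ] , (n , refl) , [-]
        , (λ { _ (here refl) → y })
        , λ { _ m (here refl) y′ m<n → contradiction m<n (ℕ.≤⇒≯ (n≤ m y′)) }
    }
    where
    ∈-[] : m ∈ [ n ] → m ≡ n
    ∈-[] (here eq) = eq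

  -- On a bad sequence the dichotomy is applied to the reversed order: if it always holds, the
  -- subsequence descends strictly; if it never holds, the subsequence is an antichain.
  wqo-↾ : (P : Ordered) → IsWqo P → ∀ Z → Z ⊆ ⋃ Singleton → InfiniteSubsetℕ Z →
    (x : FinSub → Ordered.Carrier P) → GoodPair (Singleton ↾ Z) λ s t → Ordered._≤_ P (x s) (x t)
  wqo-↾ P (no-antichain , no-descent) Z Z⊆ Z-inf x = dne λ bad →
    refute (λ s t s∈ t∈ s◁t le → bad (s , t , s∈ , t∈ , s◁t , le))
           (dichotomy (λ s t → Ordered._≤_ P (x t) (x s)) Z⊆ Z-inf)
    where
    open Ramsey singletons
    refute : Pairs Z (λ s t → ¬ Ordered._≤_ P (x s) (x t)) →
      Refinement Z (λ W → Pairs W (λ s t → Ordered._≤_ P (x t) (x s)) ⊎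
                          Pairs W (λ s t → ¬ Ordered._≤_ P (x t) (x s))) → ⊥
    refute bad (W , W⊆Z , W-inf , split) = split-cases split
      where
      e : ℕ → ℕ
      e zero    = proj₁ (W-inf 0)
      e (suc k) = proj₁ (W-inf (suc (e k)))

      e∈ : ∀ k → W (e k)
      e∈ zero    = proj₂ (proj₂ (W-inf 0))
      e∈ (suc k) = proj₂ (proj₂ (W-inf (suc (e k))))

      e-step : ∀ k → e k < e (suc k)
      e-step k = proj₁ (proj₂ (W-inf (suc (e k))))

      e-mono : ∀ {m n} → m < n → e m < e n
      e-mono {m} {suc n} (s≤s m≤n) with ℕ.m≤n⇒m<n∨m≡n m≤n
      ... | inj₁ m<n  = ℕ.<-trans (e-mono m<n) (e-step n)
      ... | inj₂ refl = e-step m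

      at : ∀ {V R} → Pairs V R → W ⊆ V → ∀ {m n} → m < n → R [ e m ] [ e n ]
      at all W⊆V {m} {n} m<n = all _ _ ((_ , refl) , W⊆V _ (e∈ m) ∷ []) ((_ , refl) , W⊆V _ (e∈ n) ∷ [])
        (e-mono m<n , _ , _ , refl)

      split-cases : Pairs W (λ s t → Ordered._≤_ P (x t) (x s)) ⊎
                    Pairs W (λ s t → ¬ Ordered._≤_ P (x t) (x s)) → ⊥
      split-cases (inj₁ down) = no-descent (x ∘ [_] ∘ e , λ k →
        at down (λ _ → id) (ℕ.n<1+n k) , at bad W⊆Z (ℕ.n<1+n k))
      split-cases (inj₂ ¬down) = no-antichain (x ∘ [_] ∘ e , incomparable)
        where
        incomparable : InfiniteAntichain P (x ∘ [_] ∘ e)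
        incomparable m n m≢n with ℕ.<-cmp m n
        ... | tri< m<n _ _ = at bad W⊆Z m<n
        ... | tri≈ _ m≡n _ = contradiction m≡n m≢n
        ... | tri> _ _ n<m = at ¬down (λ _ → id) n<m

  -- The three preservation properties of the product.

  module _ (I : Poset₀) (P : Poset₀.Carrier I → PosetWith0) where
    open Product I P
    open DS I P
    open Elem

    private
      Iₒ : Ordered
      Iₒ = Poset⇒Ordered I

      Pₒ : Poset₀.Carrier I → Ordered
      Pₒ i = Poset⇒Ordered (PosetWith0.poset (P i))

    product-αWqo : (α : CountableOrdinal) → IsαWqo Iₒ α → (∀ i → IsαWqo (Pₒ i) α) → IsαWqo product α
    product-αWqo α I-wqo P-wqo B isBarrier type≤ f = Good-total product isBarrier f λ F →
      good isBarrier F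
        (λ Z Z⊆B Z-inf x _ → αWqo-↾ Iₒ α I-wqo isBarrier type≤ Z Z⊆B Z-inf x)
        (λ Z Z⊆B Z-inf i _ → αWqo-↾ (Pₒ i) α (P-wqo i) isBarrier type≤ Z Z⊆B Z-inf λ s → fun (F s) i)

    -- Every sequence has a pair `m < n` with `g m ≤DS g n`. This excludes antichains at once; in a
    -- descending sequence transitivity brings `n` down to `suc m`, a contradiction.
    product-wqo : IsWqo Iₒ → (∀ i → IsWqo (Pₒ i)) → IsWqo product
    product-wqo I-wqo P-wqo =
      (λ (g , antichain) → let m , n , m<n , le = good-pair g in antichain m n (ℕ.<⇒≢ m<n) le) ,
      (λ (g , descent) → let m , n , m<n , le = good-pair g
                             o , eq = ℕ.m≤n⇒∃[o]m+o≡n m<n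
        in proj₂ (descent m) (extend g descent m o (subst (λ n → g m ≤DS g n) (sym eq) le)))
      where
      head : FinSub → ℕ
      head []      = 0
      head (n ∷ _) = n

      head-mono : Singleton s → Singleton t → s ◁ t → head s < head t
      head-mono (_ , refl) (_ , refl) (m<n , _) = m<n

      good-pair : ∀ g → ∃₂ λ m n → m < n × g m ≤DS g n
      good-pair g =
        let s , t , s∈ , t∈ , s◁t , le = good singletons (g ∘ head)
              (λ Z Z⊆ Z-inf x _ → wqo-↾ Iₒ I-wqo Z Z⊆ Z-inf x)
              (λ Z Z⊆ Z-inf i _ → wqo-↾ (Pₒ i) (P-wqo i) Z Z⊆ Z-inf λ s → fun (g (head s)) i)
        in head s , head t , head-mono s∈ t∈ s◁t , le

      extend : ∀ g → StrictlyDecreasing product g → ∀ m o → g m ≤DS g (suc m + o) → g m ≤DS g (suc m)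
      extend g descent m zero    le = subst (λ n → g m ≤DS g n) (ℕ.+-identityʳ (suc m)) le
      extend g descent m (suc o) le = extend g descent m o
        (≤DS-trans (g m) (g (suc m + suc o)) (g (suc m + o)) le
          (subst (λ n → g n ≤DS g (suc m + o)) (sym (ℕ.+-suc (suc m) o)) (proj₁ (descent (suc m + o)))))

    product-σBqo : IsσBqo Iₒ → (∀ i → IsσBqo (Pₒ i)) → IsσBqo product
    product-σBqo (I-wqo , QI , QI-cover , QI-bqo) P-σ =
      product-wqo I-wqo (proj₁ ∘ P-σ) , Q , Q-cover , Q-bqo
      where
      QP : ∀ i → ℕ → PosetWith0.Carrier (P i) → Set
      QP i = proj₁ (proj₂ (P-σ i))

      -- The given pieces need not increase with their index, hence the bounded existential in place
      -- of membership in the piece `n`.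
      Q : ℕ → Elem → Set
      Q n f = ∀ i → NonZero f i →
        (∃[ k ] (k ≤ n × QI k i)) × (∃[ k ] (k ≤ n × QP i k (fun f i)))

      Q-cover : ∀ f → ∃[ n ] Q n f
      -- Finiteness of the support makes the ranks of its indices bounded.
      Q-cover f = max 0 (map rank (support f)) , λ i nonzero →
        let rank≤ = ∈⇒≤max (map rank (support f)) (∈-map⁺ rank (finSupp f i nonzero))
            k , i∈ = QI-cover i
            l , fi∈ = proj₁ (proj₂ (proj₂ (P-σ i))) (fun f i)
        in (k , ℕ.≤-trans (ℕ.m≤m⊔n k l) rank≤ , i∈) , (l , ℕ.≤-trans (ℕ.m≤n⊔m k l) rank≤ , fi∈)
        where
        rank : Poset₀.Carrier I → ℕ
        rank i = proj₁ (QI-cover i) ⊔ proj₁ (proj₁ (proj₂ (proj₂ (P-σ i))) (fun f i))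

      Q-bqo : ∀ n → IsBqo (restrict product (Q n))
      Q-bqo n α B isBarrier type≤ f = Good-total (restrict product (Q n)) isBarrier f λ F →
        good isBarrier (proj₁ ∘ F)
          (λ Z Z⊆B Z-inf x nonzero → bqo-union-↾ Iₒ QI QI-bqo α isBarrier type≤ n Z Z⊆B Z-inf x
            λ s s∈ → proj₁ (proj₂ (F s) (x s) (nonzero s s∈)))
          (λ Z Z⊆B Z-inf i nonzero → bqo-union-↾ (Pₒ i) (QP i) (proj₂ (proj₂ (proj₂ (P-σ i)))) α
            isBarrier type≤ n Z Z⊆B Z-inf (λ s → fun (proj₁ (F s)) i)
            λ s s∈ → proj₂ (proj₂ (F s) i (nonzero s s∈)))

mainTheorem9 : (em : ∀ {ℓ} → ExcludedMiddle ℓ)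
    → (I : Poset₀) (P : Poset₀.Carrier I → PosetWith0)
    → ((α : CountableOrdinal) → IsInfiniteOrdinal α
    → IsαWqo (Poset⇒Ordered I) α
    → (∀ i → IsαWqo (Poset⇒Ordered (PosetWith0.poset (P i))) α)
    → IsαWqo (DS.product I P) α)
    × (IsBqo (Poset⇒Ordered I)
    → (∀ i → IsBqo (Poset⇒Ordered (PosetWith0.poset (P i))))
    → IsBqo (DS.product I P))
    × (IsσBqo (Poset⇒Ordered I)
    → (∀ i → IsσBqo (Poset⇒Ordered (PosetWith0.poset (P i))))
    → IsσBqo (DS.product I P))
mainTheorem9 em I P =
  (λ α _ → product-αWqo I P α) ,
  (λ I-bqo P-bqo α → product-αWqo I P α (I-bqo α) (λ i → P-bqo i α)) ,
  product-σBqo I P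
  where open Classical em
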